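{- Let $s,s'$ be nonnegative integers with $s'<s$, and let $G$ be a weakly modular graph that is $(s,s')$-dismantlable. Then $G$ is $184s$-hyperbolic.
   Context: All graphs are undirected, connected, without loops or multiple edges, possibly infinite; $d$ is the shortest-path distance. $B_r(v,G)=\{x: d_G(v,x)\le r\}$; for a vertex $u$, $B_r(v,G-\{u\})$ is the ball of radius $r$ around $v$ in the graph obtained from $G$ by deleting $u$. Given a well-order $\preceq$ on $V$, $X_v=\{w: w\preceq v\}$. $G$ is $(s,s')$-dismantlable if $V$ admits a well-order $\preceq$ such that for each vertex $v$ (other than the least element) there is a vertex $u\ne v$, $u\preceq v$, with $B_s(v,G-\{u\})\cap X_v\subseteq B_{s'}(u,G)$. $G$ is weakly modular if (triangle condition) for any $u,v,w$ with $1=d(v,w)<d(u,v)=d(u,w)$ there is a common neighbor $x$ of $v,w$ with $d(u,x)=d(u,v)-1$, and (quadrangle condition) for any $u,v,w,z$ with $d(v,z)=d(w,z)=1$ and $2=d(v,w)\le d(u,v)=d(u,w)=d(u,z)-1$ there is a common neighbor $x$ of $v,w$ with $d(u,x)=d(u,v)-1$. A graph is $\delta$-hyperbolic if for any four vertices $u,v,x,y$ the two largest of $d(u,v)+d(x,y)$, $d(u,x)+d(v,y)$, $d(u,y)+d(v,x)$ differ by at most $2\delta$. -}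

module Defs where

open import Level using (Level; _⊔_)
open import Data.Nat using (ℕ; zero; suc; _+_; _*_; _∸_; _≤_; _<_) renaming (_⊔_ to _⊔ℕ_; _⊓_ to _⊓ℕ_)
open import Data.Product using (Σ; ∃; _×_; _,_)
open import Relation.Nullary using (¬_)
open import Relation.Binary.PropositionalEquality using (_≡_; _≢_)
open import Relation.Binary.Structures using (IsTotalOrder)
open import Induction.WellFounded using (WellFounded)

module _ {a b : Level} {V : Set a} (E : V → V → Set b) where

  data Walk : V → V → ℕ → Set (a ⊔ b) where
    nil  : ∀ {x} → Walk x x 0
    cons : ∀ {x y z n} → E x y → Walk y z n → Walk x z (suc n)

  data WalkAvoid (u : V) : V → V → ℕ → Set (a ⊔ b) where
    nil  : ∀ {x} → x ≢ u → WalkAvoid u x x 0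
    cons : ∀ {x y z n} → x ≢ u → E x y → WalkAvoid u y z n → WalkAvoid u x z (suc n)

record Graph (a b : Level) : Set (Level.suc (a ⊔ b)) where
  field
    V         : Set a
    E         : V → V → Set b
    E-sym     : ∀ {x y} → E x y → E y x
    E-irrefl  : ∀ {x} → ¬ E x x
    connected : ∀ x y → ∃ λ n → Walk E x y n

module _ {a b : Level} (G : Graph a b) where
  open Graph G

  Dist : V → V → ℕ → Set (a ⊔ b)
  Dist x y n = Walk E x y n × (∀ m → Walk E x y m → n ≤ m)

  InBall : ℕ → V → V → Set (a ⊔ b)
  InBall r v x = ∃ λ n → n ≤ r × Walk E v x n

  -- x ∈ B_r(v, G - {u})   (v ≠ u is ensured by the walk avoiding u)
  InBallMinus : V → ℕ → V → V → Set (a ⊔ b)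
  InBallMinus u r v x = ∃ λ n → n ≤ r × WalkAvoid E u v x n

  record WellOrder (ℓ : Level) : Set (a ⊔ Level.suc ℓ) where
    field
      _≼_     : V → V → Set ℓ
      isTotal : IsTotalOrder _≡_ _≼_
      wf      : WellFounded (λ x y → x ≼ y × x ≢ y)

  IsDismantlable : ℕ → ℕ → Set (Level.suc (a ⊔ b))
  IsDismantlable s s' =
    Σ (WellOrder (a ⊔ b)) λ W → let open WellOrder W in
      ∀ v → ¬ (∀ w → v ≼ w) →
        Σ V λ u → u ≢ v × u ≼ v ×
          (∀ x → InBallMinus u s v x → x ≼ v → InBall s' u x)

  WeaklyModular : Set (a ⊔ b)
  WeaklyModular = TriangleCondition × QuadrangleCondition
    where
    TriangleCondition : Set (a ⊔ b)
    TriangleCondition = ∀ u v w n →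
      Dist v w 1 → 1 < n → Dist u v n → Dist u w n →
      Σ V λ x → E x v × E x w × Dist u x (n ∸ 1)
    QuadrangleCondition : Set (a ⊔ b)
    QuadrangleCondition = ∀ u v w z n →
      Dist v z 1 → Dist w z 1 → Dist v w 2 → 2 ≤ n →
      Dist u v n → Dist u w n → Dist u z (suc n) →
      Σ V λ x → E x v × E x w × Dist u x (n ∸ 1)

TwoLargestWithin : ℕ → ℕ → ℕ → ℕ → Set
TwoLargestWithin k p q r =
  ((p ⊔ℕ q) ⊔ℕ r) ∸ (((p ⊓ℕ q) ⊔ℕ (q ⊓ℕ r)) ⊔ℕ (p ⊓ℕ r)) ≤ k

module _ {a b : Level} (G : Graph a b) where
  open Graph G

  Hyperbolic : ℕ → Set (a ⊔ b)
  Hyperbolic δ = ∀ u v x y (duv dxy dux dvy duy dvx : ℕ) →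
    Dist G u v duv → Dist G x y dxy → Dist G u x dux →
    Dist G v y dvy → Dist G u y duy → Dist G v x dvx →
    TwoLargestWithin (2 * δ) (duv + dxy) (dux + dvy) (duy + dvx)

{-# OPTIONS --safe #-}

-- Let X be a finite set of vertices each of which is the midpoint of a geodesic of length 2s
-- with ends p, q in X, and let v be its largest element.  A vertex u dominating v has
-- d(u,p), d(u,q) < s: either p is reached from v inside B_s(v, G-u), or the path from v to p
-- runs through u.  This contradicts d(p,q) = 2s, so no such X exists; in particular there is no
-- closed walk that is geodesic on every window of length 2s.
--
-- In a weakly modular graph every triple has a quasi-median whose core is a metric triangle
-- u v w with all of I(v,w) at distance d(u,v) from u.  Cutting the corners off a metric triangle
-- of side 6s gives a locally geodesic hexagon, so metric triangles have side < 6s; two vertices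
-- of I(u,v) on the same level at distance at least 10s give a locally geodesic bigon, so
-- intervals are thin.  Comparing the quasi-medians of u,v,x and of u,x,y then yields
-- the four-point inequality with an error of at most 16s.
module Submission where

open import Defs
open import Level using (Level; _⊔_)
open import Data.Nat using (ℕ; zero; suc; _+_; _*_; _∸_; _≤_; _<_; z≤n; s≤s; _≤?_; _⊓_) renaming (_⊔_ to _⊔ℕ_)
open import Data.Nat.Properties
open import Data.Nat.Induction using (<-wellFounded)
open import Data.Nat.Tactic.RingSolver using (solve)
open import Data.List using ([]; _∷_)
open import Data.Product using (Σ; ∃; _×_; _,_; proj₁; proj₂)
open import Data.Sum using (_⊎_; inj₁; inj₂; [_,_])
open import Data.Empty using (⊥)
open import Function using (_∘_; case_of_; id)
open import Induction.WellFounded using (Acc; acc)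
open import Relation.Nullary using (¬_; yes; no; contradiction)
open import Relation.Nullary.Decidable using (decidable-stable; ¬¬-excluded-middle)
open import Relation.Binary.Structures using (IsTotalOrder)
open import Relation.Binary.PropositionalEquality
  using (_≡_; _≢_; refl; sym; trans; cong; cong₂; subst; module ≡-Reasoning)

-- Distances of G need not be decidable, so existence statements live in the
-- double negation monad; the inequalities finally extracted are stable.
private
  variable
    ℓ₁ ℓ₂ : Level
    A : Set ℓ₁
    B : Set ℓ₂

return : A → ¬ ¬ A
return x k = k x

_>>=_ : ¬ ¬ A → (A → ¬ ¬ B) → ¬ ¬ B
(m >>= f) k = m λ x → f x k

≤-stable : ∀ {m n} → ¬ ¬ (m ≤ n) → m ≤ n
≤-stable = decidable-stable (_ ≤? _)

-- Linear arithmetic by certificate: `m ≤ n` is the sum of the inequalities used, `e` is the slack,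
-- and the remaining identity goes to the ring solver.
cancel-≤ : ∀ {l r m n} e → m ≤ n → l + n + e ≡ r + m → l ≤ r
cancel-≤ {l} {r} {m} {n} e m≤n eq = +-cancelʳ-≤ m l r (begin
  l + m     ≤⟨ +-monoʳ-≤ l m≤n ⟩
  l + n     ≤⟨ m≤m+n (l + n) e ⟩
  l + n + e ≡⟨ eq ⟩
  r + m     ∎)
  where open ≤-Reasoning

cancel-≡ : ∀ {l r m n : ℕ} → m ≡ n → l + n ≡ r + m → l ≡ r
cancel-≡ {l} {r} {m} refl eq = +-cancelʳ-≡ m l r eq

-- Walks and lower bounds on distances.

module Walks {a b : Level} (G : Graph a b) where
  open Graph G

  infixr 5 _++_

  _++_ : ∀ {x y z m n} → Walk E x y m → Walk E y z n → Walk E x z (m + n)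
  nil      ++ q = q
  cons e p ++ q = cons e (p ++ q)

  edge : ∀ {x y} → E x y → Walk E x y 1
  edge e = cons e nil

  rev : ∀ {x y n} → Walk E x y n → Walk E y x n
  rev nil                = nil
  rev (cons {n = n} e p) = subst (Walk E _ _) (+-comm n 1) (rev p ++ edge (E-sym e))

  cast : ∀ {x y m n} → m ≡ n → Walk E x y m → Walk E x y n
  cast = subst (Walk E _ _)

  split : ∀ {x y} m {n} → Walk E x y (m + n) → ∃ λ z → Walk E x z m × Walk E z y n
  split zero    p          = _ , nil , p
  split (suc m) (cons e p) = let z , q , r = split m p in z , cons e q , r

  walk-0 : ∀ {x y} → Walk E x y 0 → x ≡ y
  walk-0 nil = refl

  walk-1 : ∀ {x y} → Walk E x y 1 → E x y
  walk-1 (cons e nil) = e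

  Far : V → V → ℕ → Set (a ⊔ b)
  Far x y n = ∀ m → Walk E x y m → n ≤ m

  far-sym : ∀ {x y n} → Far x y n → Far y x n
  far-sym f m p = f m (rev p)

  dist-sym : ∀ {x y n} → Dist G x y n → Dist G y x n
  dist-sym (p , f) = rev p , far-sym f

  dist-unique : ∀ {x y m n} → Dist G x y m → Dist G x y n → m ≡ n
  dist-unique (p , f) (q , g) = ≤-antisym (f _ q) (g _ p)

  far-≤ : ∀ {x y m n} → m ≤ n → Far x y n → Far x y m
  far-≤ m≤n f l p = ≤-trans m≤n (f l p)

  far-narrow : ∀ {x y p q k n} i j → Far x y k → Walk E x p i → Walk E q y j →
    i + n + j ≤ k → Far p q n
  far-narrow {n = n} i j f xp qy le m pq =
    cancel-≤ 0 (+-mono-≤ le (f _ (xp ++ pq ++ qy))) (lemma _)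
    where
    lemma : ∀ k → n + (k + (i + (m + j))) + 0 ≡ m + (i + n + j + k)
    lemma k = solve (n ∷ k ∷ i ∷ m ∷ j ∷ [])

  far-narrowʳ : ∀ {x y q k n} j → Far x y k → Walk E q y j → n + j ≤ k → Far x q n
  far-narrowʳ j f = far-narrow 0 j f nil

  far-narrowˡ : ∀ {x y p k n} i → Far x y k → Walk E x p i → i + n ≤ k → Far p y n
  far-narrowˡ {k = k} {n} i f xp le = far-narrow i 0 f xp nil (subst (_≤ k) (sym (+-identityʳ (i + n))) le)

  dist-prefix : ∀ {x y z m n} → Far x z (m + n) → Walk E x y m → Walk E y z n → Dist G x y m
  dist-prefix f p q = p , far-narrowʳ _ f q ≤-refl

  dist-suffix : ∀ {x y z m n} → Far x z (m + n) → Walk E x y m → Walk E y z n → Dist G y z n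
  dist-suffix f p q = q , far-narrowˡ _ f p ≤-refl

  ∃dist : ∀ x y → ¬ ¬ ∃ (Dist G x y)
  ∃dist x y = let n , p = connected x y in go n (<-wellFounded n) p
    where
    go : ∀ n → Acc _<_ n → Walk E x y n → ¬ ¬ ∃ (Dist G x y)
    go n (acc rs) p k = k (n , p , λ m q → ≮⇒≥ λ m<n → go m (rs m<n) q k)

  far-edge : ∀ {x y} → E x y → Far x y 1
  far-edge e zero    nil = contradiction e E-irrefl
  far-edge e (suc m) _   = s≤s z≤n

-- Consequences of the triangle and quadrangle conditions.

module Modular {a b : Level} (G : Graph a b) (wm : WeaklyModular G) where
  open Graph G
  open Walks G

  -- The condition is assumed only from distance 2 on; at distance 1 the vertex `u` itself is the
  -- common neighbour. The same holds for `quadrangle`.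
  triangle : ∀ {u v w n} → Dist G u v (suc n) → Dist G u w (suc n) → E v w →
    Σ V λ x → E x v × E x w × Walk E u x n
  triangle {n = zero} (uv , _) (uw , _) e = _ , walk-1 uv , walk-1 uw , nil
  triangle {n = suc n} duv duw e =
    let x , xv , xw , dux = proj₁ wm _ _ _ _ (edge e , far-edge e) (s≤s (s≤s z≤n)) duv duw
    in x , xv , xw , proj₁ dux

  quadrangle : ∀ {u v w z n} → Dist G u v (suc n) → Dist G u w (suc n) → Dist G u z (suc (suc n)) →
    E v z → E w z → Far v w 2 → Σ V λ x → E x v × E x w × Walk E u x n
  quadrangle {n = zero} (uv , _) (uw , _) duz vz wz f = _ , walk-1 uv , walk-1 uw , nil
  quadrangle {n = suc n} duv duw duz vz wz f =
    let x , xv , xw , dux = proj₂ wm _ _ _ _ _ (edge vz , far-edge vz) (edge wz , far-edge wz)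
                              (cons vz (edge (E-sym wz)) , f) (s≤s (s≤s z≤n)) duv duw duz
    in x , xv , xw , proj₁ dux

  unsnoc : ∀ {x y n} → Walk E x y (suc n) → ∃ λ z → Walk E x z n × E z y
  unsnoc {n = n} p = let z , q , r = split n (cast (+-comm 1 n) p) in z , q , walk-1 r

  far-pred : ∀ {x y z n} → Far x y (suc n) → E z y → Far x z n
  far-pred {n = n} f e = far-narrowʳ 1 f (edge e) (≤-reflexive (+-comm n 1))

  far-2 : ∀ {x y z n} → Far x y (suc (suc n)) → Walk E x z n → Far y z 2
  far-2 {n = n} f p = far-sym (far-narrowˡ n f p (≤-reflexive (+-comm n 2)))

  -- w x z is a triangle on top of a square z x y t; applying the triangle condition
  -- from w to the edge y t yields a common neighbour of w, y and t.
  house : ∀ {u v w x y z k n} → Far u w (suc k) → Dist G u x (suc k) → Walk E u y k → Walk E u z k →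
    Walk E v y n → Far v w (suc (suc n)) → Far v z (suc (suc n)) →
    E w x → E w z → E z x → E x y → Σ V λ q → E w q × Walk E u q k × Walk E v q (suc n)
  house {k = zero} fuw dux nil nil vy fvw fvz wx wz zx xy = contradiction (<⇒≤ (fvz _ vy)) 1+n≰n
  house {k = suc k} {n} fuw dux uy uz vy fvw fvz wx wz zx xy =
    let duz = uz , far-pred (proj₂ dux) zx
        duy = uy , far-pred (proj₂ dux) (E-sym xy)
        t , tz , ty , ut = quadrangle duz duy dux zx (E-sym xy) (far-2 fvz vy)
        q , qy , qt , wq = triangle (cons wx (edge xy) , far-2 fvw vy)
                                    (cons wz (edge (E-sym tz)) , far-2 fuw ut) (E-sym ty)
    in q , walk-1 wq , cast (+-comm k 1) (ut ++ edge (E-sym qt)) ,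
       cast (+-comm n 1) (vy ++ edge (E-sym qy))

  -- If `u` is closer to `v` than to `w`, geodesics from `w` to `u` and to `v` can share their first
  -- edge. Induction on `d(v,w)`: let `x` precede `w` on a geodesic from `v`. If `d(u,x) = k`, then
  -- `x` serves. Otherwise induction gives a neighbour `y` of `x` one step closer to both `u` and
  -- `v`.
  branch : ∀ {n u v w c k} → Dist G u v c → Dist G u w (suc k) → Dist G v w (suc n) → c ≤ k →
    ¬ ¬ Σ V λ y → E w y × Walk E u y k × Walk E v y n
  branch {n = zero} {k = k} (uv , _) (_ , fuw) (vw , _) c≤k =
    return (_ , E-sym (walk-1 vw) ,
            cast (≤-antisym c≤k (≤-pred (≤-trans (fuw _ (uv ++ vw)) (≤-reflexive (+-comm _ 1))))) uv , nil)
  branch {suc n} {u} {v} {w} {c} {k} duv duw@(uw , fuw) dvw@(vw , fvw) c≤k = do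
    let x , vx , xw = unsnoc vw
        fvx = far-pred fvw xw
    m , dux@(ux , fux) ← ∃dist u x
    case m≤n⇒m<n∨m≡n (far-pred fuw xw m ux) of λ where
      (inj₂ refl) → return (x , E-sym xw , ux , vx)
      (inj₁ k<m) → step x vx fvx xw m k<m dux
    where
    step : ∀ x → Walk E v x (suc n) → Far v x (suc n) → E x w → ∀ m → k < m → Dist G u x m →
      ¬ ¬ Σ V λ y → E w y × Walk E u y k × Walk E v y (suc n)
    step x vx fvx xw (suc m) (s≤s k≤m) dux@(ux , fux) = do
      y , xy , uy , vy ← branch duv dux (vx , fvx) (≤-trans c≤k k≤m)
      let duy = uy , far-pred fux (E-sym xy)
          fwy = far-2 fvw vy
      case m≤n⇒m<n∨m≡n k≤m of λ where
        -- Here `d(u,x) = k + 2`, so `w` and `y` both lie one level below `x` and the quadrangle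
        -- condition applies.
        (inj₁ k<m) → λ g →
          case ≤-antisym k<m (≤-pred (≤-trans (fux _ (uw ++ edge (E-sym xw)))
                                              (≤-reflexive (+-comm _ 1)))) of λ where
            refl → let z , zw , zy , uz = quadrangle duw duy dux (E-sym xw) (E-sym xy) fwy in
                   g (z , E-sym zw , uz , cast (+-comm n 1) (vy ++ edge (E-sym zy)))
        -- Here `d(u,x) = k + 1 = d(u,w)`. The vertex `z` over the edge `w x` serves unless it is
        -- too far from `v`, which is the configuration of `house`.
        (inj₂ refl) → do
          let z , zw , zx , uz = triangle duw dux (E-sym xw)
          e , vz , fvz ← ∃dist v z
          case e ≤? suc n of λ where
            (yes e≤) → return (z , E-sym zw , uz , cast (≤-antisym e≤ (far-pred fvw zw e vz)) vz)
            (no e≰) → return (house fuw dux uy uz vy fvw (far-≤ (≰⇒> e≰) fvz)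
                                (E-sym xw) (E-sym zw) zx xy)

  -- Some neighbour y of u lies in both I(u,v) and I(u,w).
  Reducible : V → V → V → Set (a ⊔ b)
  Reducible u v w = Σ V λ y → ∃ λ m → ∃ λ n → E u y × Walk E v y m × Walk E w y n ×
    Far u v (suc m) × Far u w (suc n)

  reducible-swap : ∀ {u v w} → Reducible u v w → Reducible u w v
  reducible-swap (y , m , n , e , vy , wy , fv , fw) = y , n , m , e , wy , vy , fw , fv

  -- Were `d(u,v) < d(u,w)`, `branch` would reduce the corner `w`. Hence a triple with no reducible
  -- corner is equilateral.
  irreducible-≤ : ∀ {u v w c m n} → ¬ Reducible w u v → Dist G u v c → Dist G u w m → Dist G v w n → m ≤ c
  irreducible-≤ {m = zero} irr duv duw dvw = z≤n
  irreducible-≤ {m = suc k} {zero} irr duv duw (vw , _) with refl ← walk-0 vw = proj₂ duw _ (proj₁ duv)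
  irreducible-≤ {m = suc k} {suc n} irr duv duw dvw = ≮⇒≥ λ m<c → branch duv duw dvw (≤-pred m<c)
    λ (y , e , uy , vy) → irr (y , k , n , e , uy , vy , far-sym (proj₂ duw) , far-sym (proj₂ dvw))

  -- Metric triangles and the distances from a corner to the opposite side.

  -- Irreducible corners say that the intervals at each corner meet only there. The common side
  -- length `k` then follows from `irreducible-≤`, but is recorded for convenience.
  record MetricTriangle (u v w : V) (k : ℕ) : Set (a ⊔ b) where
    field
      duv  : Dist G u v k
      dvw  : Dist G v w k
      duw  : Dist G u w k
      irrᵘ : ¬ Reducible u v w
      irrᵛ : ¬ Reducible v u w
      irrʷ : ¬ Reducible w u v

  swap : ∀ {u v w k} → MetricTriangle u v w k → MetricTriangle v u w k
  swap t = record
    { duv = dist-sym duv ; dvw = duw ; duw = dvw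
    ; irrᵘ = irrᵛ ; irrᵛ = irrᵘ ; irrʷ = irrʷ ∘ reducible-swap }
    where open MetricTriangle t

  rotate : ∀ {u v w k} → MetricTriangle u v w k → MetricTriangle v w u k
  rotate t = record
    { duv = dvw ; dvw = dist-sym duw ; duw = dist-sym duv
    ; irrᵘ = irrᵛ ∘ reducible-swap ; irrᵛ = irrʷ ∘ reducible-swap ; irrʷ = irrᵘ }
    where open MetricTriangle t

  -- If `x` were closer to `u` than `w` is, `branch` would give a neighbour of `w` on geodesics to
  -- `u` and to `x`, hence also to `v`, making `w` reducible.
  side-far : ∀ {u v w x i j k} → MetricTriangle u v w k → Walk E v x i → Walk E x w j → i + j ≡ k → Far u x k
  side-far {j = zero} t vx xw eq with refl ← walk-0 xw = proj₂ (MetricTriangle.duw t)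
  side-far {i = i} {suc j} {zero} t vx xw eq m ux = z≤n
  side-far {u} {x = x} {i} {suc j} {suc k} t vx xw eq m ux = ≤-stable do
    l , dux ← ∃dist u x
    return (≤-trans (≮⇒≥ λ l<k → branch dux duw dxw (≤-pred l<k)
      λ (y , e , uy , xy) → irrʷ (y , k , i + j , e , uy , vx ++ xy , far-sym (proj₂ duw) ,
        far-sym (subst (Far _ _) (sym (trans (sym (+-suc i j)) eq)) (proj₂ dvw))))
      (proj₂ dux m ux))
    where
    open MetricTriangle t
    dxw : Dist G x _ (suc j)
    dxw = dist-suffix (subst (Far _ _) (sym eq) (proj₂ dvw)) vx xw

  -- Otherwise the quadrangle condition produces a vertex of I(v,w) closer to u than k.
  no-peak : ∀ {u v w p x i j k} → MetricTriangle u v w k → Walk E v p i → E p x → Walk E x w j →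
    i + suc j ≡ k → Dist G u p k → ¬ Dist G u x (suc k)
  no-peak {j = zero} t vp px xw eq dup dux with refl ← walk-0 xw =
    1+n≰n (proj₂ dux _ (proj₁ (MetricTriangle.duw t)))
  no-peak {i = i} {suc j} {zero} t vp px xw eq = contradiction (trans (sym (+-suc i _)) eq) λ ()
  no-peak {i = i} {suc j} {suc k} t vp px xw eq dup dux =
    branch duw dux (dist-sym dxw) ≤-refl λ (y , xy , uy , wy) →
      let q , qp , qy , uq = quadrangle dup (uy , far-pred (proj₂ dux) (E-sym xy)) dux px (E-sym xy)
                               (far-narrow i j (proj₂ dvw) vp (rev wy)
                                 (≤-reflexive (trans (+-assoc i 2 j) eq)))
      in 1+n≰n (side-far t (vp ++ edge (E-sym qp)) (cons qy (rev wy))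
                  (trans (+-assoc i 1 (suc j)) eq) _ uq)
    where
    open MetricTriangle t
    dxw = dist-suffix (subst (Far _ _) (sym (trans (+-assoc i 1 (suc j)) eq)) (proj₂ dvw)) (vp ++ edge px) xw

  -- Walk along the side from `v`, where the distance is `k`: by `side-far` it never drops, and by
  -- `no-peak` it never rises.
  side-dist : ∀ {u v w x i j k} → MetricTriangle u v w k → Walk E v x i → Walk E x w j → i + j ≡ k →
    ¬ ¬ Dist G u x k
  side-dist {i = zero} t vx xw eq with refl ← walk-0 vx = return (MetricTriangle.duv t)
  side-dist {u} {x = x} {i = suc i} {j} {k} t vx xw eq = do
    let p , vp , px = unsnoc vx
        eq′ = trans (+-suc i j) eq
    dup ← side-dist t vp (cons px xw) eq′
    m , dux ← ∃dist u x
    case m≤n⇒m<n∨m≡n (side-far t vx xw eq _ (proj₁ dux)) of λ where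
      (inj₂ refl) → return dux
      (inj₁ k<m) → contradiction
        (subst (Dist G u x)
          (≤-antisym (proj₂ dux _ (cast (+-comm k 1) (proj₁ dup ++ edge px))) k<m) dux)
        (no-peak t vp px xw eq′ dup)

  -- Quasi-medians and cutting off corners.

  -- The three `Far` fields make each path leg, core side, leg a geodesic.
  record QuasiMedian (u v w : V) : Set (a ⊔ b) where
    field
      {u′ v′ w′} : V
      {α β γ k}  : ℕ
      uu′      : Walk E u u′ α
      vv′      : Walk E v v′ β
      ww′      : Walk E w w′ γ
      core     : MetricTriangle u′ v′ w′ k
      fuv      : Far u v (α + k + β)
      fvw      : Far v w (β + k + γ)
      fuw      : Far u w (α + k + γ)

    duv : Dist G u v (α + k + β)
    duv = (uu′ ++ proj₁ (MetricTriangle.duv core)) ++ rev vv′ , fuv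

    dvw : Dist G v w (β + k + γ)
    dvw = (vv′ ++ proj₁ (MetricTriangle.dvw core)) ++ rev ww′ , fvw

    duw : Dist G u w (α + k + γ)
    duw = (uu′ ++ proj₁ (MetricTriangle.duw core)) ++ rev ww′ , fuw

  far-rev : ∀ {x y} m {k n} → Far x y (m + k + n) → Far y x (n + k + m)
  far-rev {x} {y} m {k} {n} f = far-sym (subst (Far x y) (lemma m k n) f)
    where
    lemma : ∀ m k n → m + k + n ≡ n + k + m
    lemma m k n = solve (m ∷ k ∷ n ∷ [])

  qm-rotate : ∀ {u v w} → QuasiMedian u v w → QuasiMedian v w u
  qm-rotate q = record { uu′ = vv′ ; vv′ = ww′ ; ww′ = uu′ ; core = rotate core
                       ; fuv = fvw ; fvw = far-rev α fuw ; fuw = far-rev α fuv }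
    where open QuasiMedian q

  qm-swap : ∀ {u v w} → QuasiMedian u v w → QuasiMedian u w v
  qm-swap q = record { uu′ = uu′ ; vv′ = ww′ ; ww′ = vv′ ; core = rotate (swap core)
                     ; fuv = fuw ; fvw = far-rev β fvw ; fuw = fuv }
    where open QuasiMedian q

  extend : ∀ {u v w y m n} → E u y → Walk E v y m → Walk E w y n → Far u v (suc m) → Far u w (suc n) →
    QuasiMedian y v w → QuasiMedian u v w
  extend e vy wy fv fw q = record
    { uu′ = cons e uu′ ; vv′ = vv′ ; ww′ = ww′ ; core = core
    ; fuv = far-≤ (s≤s (fuv _ (rev vy))) fv ; fvw = fvw ; fuw = far-≤ (s≤s (fuw _ (rev wy))) fw }
    where open QuasiMedian q

  -- Induction on the perimeter: moving a reducible corner to the neighbour `y` shortens two sides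
  -- and keeps the third. When no corner is reducible, the triple is its own core.
  quasiMedian : ∀ u v w → ¬ ¬ QuasiMedian u v w
  quasiMedian u v w = do
    l , duv ← ∃dist u v
    m , dvw ← ∃dist v w
    n , duw ← ∃dist u w
    go duv dvw duw (<-wellFounded _)
    where
    reduce : ∀ {u v w l m n} → Dist G u v l → Dist G v w m → Dist G u w n → Reducible u v w →
      (∀ {y l′ n′} → Dist G y v l′ → Dist G v w m → Dist G y w n′ → l′ + m + n′ < l + m + n →
        ¬ ¬ QuasiMedian y v w) →
      ¬ ¬ QuasiMedian u v w
    reduce {l = l} {m} {n} duv dvw duw (y , l′ , n′ , e , vy , wy , fuv , fuw) rec = do
      q ← rec (rev vy , fyv) dvw (rev wy , fyw)
        (+-mono-<-≤ (+-monoˡ-< m (fuv _ (proj₁ duv))) (<⇒≤ (fuw _ (proj₁ duw))))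
      return (extend e vy wy fuv fuw q)
      where
      fyv = far-sym (far-pred (far-sym fuv) (E-sym e))
      fyw = far-sym (far-pred (far-sym fuw) (E-sym e))

    go : ∀ {u v w l m n} → Dist G u v l → Dist G v w m → Dist G u w n → Acc _<_ (l + m + n) →
      ¬ ¬ QuasiMedian u v w
    go {u} {v} {w} {l} {m} {n} duv dvw duw (acc rs) = do
      no irrᵘ ← ¬¬-excluded-middle {A = Reducible u v w}
        where yes r → reduce duv dvw duw r λ d₁ d₂ d₃ lt → go d₁ d₂ d₃ (rs lt)
      no irrᵛ ← ¬¬-excluded-middle {A = Reducible v u w}
        where yes r → do
                q ← reduce dvw (dist-sym duw) (dist-sym duv) (reducible-swap r)
                      λ d₁ d₂ d₃ lt → go d₁ d₂ d₃ (rs (<-≤-trans lt (≤-reflexive (cycle l m n))))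
                return (qm-rotate (qm-rotate q))
      no irrʷ ← ¬¬-excluded-middle {A = Reducible w u v}
        where yes r → do
                q ← reduce (dist-sym duw) duv (dist-sym dvw) r
                      λ d₁ d₂ d₃ lt → go d₁ d₂ d₃ (rs (<-≤-trans lt (≤-reflexive (sym (cycle n l m)))))
                return (qm-rotate q)
      let n≤l = irreducible-≤ irrʷ duv duw dvw
          m≤l = irreducible-≤ (irrʷ ∘ reducible-swap) (dist-sym duv) dvw duw
          l≤n = irreducible-≤ irrᵛ duw duv (dist-sym dvw)
          l≤m = irreducible-≤ (irrᵘ ∘ reducible-swap) (dist-sym dvw) (dist-sym duw) (dist-sym duv)
      case ≤-antisym n≤l l≤n of λ where
        refl → case ≤-antisym m≤l l≤m of λ where
          refl → return record
            { uu′ = nil ; vv′ = nil ; ww′ = nil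
            ; core = record { duv = duv ; dvw = dvw ; duw = duw ; irrᵘ = irrᵘ ; irrᵛ = irrᵛ ; irrʷ = irrʷ }
            ; fuv = subst (Far _ _) (sym (+-identityʳ l)) (proj₂ duv)
            ; fvw = subst (Far _ _) (sym (+-identityʳ l)) (proj₂ dvw)
            ; fuw = subst (Far _ _) (sym (+-identityʳ l)) (proj₂ duw) }
      where
      cycle : ∀ l m n → m + n + l ≡ l + m + n
      cycle l m n = solve (l ∷ m ∷ n ∷ [])

  -- The quasi-median of a, v, w fixes a and v, because a and v are both at distance k from w and
  -- no vertex of I(u,v) is closer to w; b is its third corner.
  subtriangle : ∀ {u v w a i j k} → MetricTriangle u v w k → Walk E u a i → Walk E a v j → i + j ≡ k →
    ¬ ¬ Σ V λ b → Walk E v b j × Walk E b w i × MetricTriangle a v b j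
  subtriangle {u} {v} {w} {a} {i} {j} t ua av refl = do
    dwa ← side-dist (rotate (rotate t)) ua av refl
    q ← quasiMedian a v w
    let module Q = QuasiMedian q
        module C = MetricTriangle Q.core
        j≡ = dist-unique dav Q.duv
        i+j≡ = dist-unique T.dvw Q.dvw
        α≡β = +-cancelʳ-≡ Q.k Q.α Q.β (+-cancelʳ-≡ Q.γ (Q.α + Q.k) (Q.β + Q.k)
                (trans (dist-unique Q.duw (dist-sym dwa)) i+j≡))
        far = side-far (rotate (rotate t)) (ua ++ Q.uu′ ++ proj₁ C.duv) (rev Q.vv′)
                (trans (+-assoc i (Q.α + Q.k) Q.β) (cong (i +_) (sym j≡)))
                _ (Q.ww′ ++ rev (proj₁ C.dvw))
        β≡0 = n≤0⇒n≡0 (+-cancelʳ-≤ (Q.γ + Q.k) Q.β 0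
                (≤-trans (≤-reflexive (trans (swapˡ Q.β Q.γ Q.k) (sym i+j≡))) far))
        α≡0 = trans α≡β β≡0
    return (collapse q α≡0 β≡0 j≡ i+j≡)
    where
    module T = MetricTriangle t
    dav : Dist G a v j
    dav = dist-suffix (proj₂ T.duv) ua av
    swapˡ : ∀ β γ k → β + (γ + k) ≡ β + k + γ
    swapˡ β γ k = solve (β ∷ γ ∷ k ∷ [])
    collapse : (q : QuasiMedian a v w) → let open QuasiMedian q in
      α ≡ 0 → β ≡ 0 → j ≡ α + k + β → i + j ≡ β + k + γ →
      Σ V λ b → Walk E v b j × Walk E b w i × MetricTriangle a v b j
    collapse record { uu′ = uu′ ; vv′ = vv′ ; ww′ = ww′ ; core = core } refl refl j≡ i+j≡
      with refl ← walk-0 uu′ | refl ← walk-0 vv′ | refl ← trans j≡ (+-identityʳ _)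
      with refl ← +-cancelʳ-≡ j i _ (trans i+j≡ (+-comm j _)) =
      _ , proj₁ (MetricTriangle.dvw core) , rev ww′ , core

-- Locally geodesic closed walks and dismantlability.

module Dismantling {a b : Level} (G : Graph a b) where
  open Graph G
  open Walks G

  -- The indices count the edges before and after the vertex, so that windows can be measured in
  -- both directions.
  data At : ∀ {x y n} → Walk E x y n → V → ℕ → ℕ → Set (a ⊔ b) where
    start : ∀ {x y n} {p : Walk E x y n} → At p x 0 n
    next  : ∀ {x y z n v i j} {e : E x y} {p : Walk E y z n} → At p v i j → At (cons e p) v (suc i) j

  On : ∀ {x y n} → Walk E x y n → V → Set (a ⊔ b)
  On p v = ∃ λ i → ∃ λ j → At p v i j

  on-next : ∀ {x y z n v} {e : E x y} {p : Walk E y z n} → On p v → On (cons e p) v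
  on-next (i , j , v∈p) = suc i , j , next v∈p

  before : ∀ {x y n v i j} {p : Walk E x y n} → At p v i j → Walk E x v i
  before start                  = nil
  before {p = cons e p} (next v∈p) = cons e (before v∈p)

  at-length : ∀ {x y n v i j} {p : Walk E x y n} → At p v i j → i + j ≡ n
  at-length start      = refl
  at-length (next v∈p) = cong suc (at-length v∈p)

  at-++ˡ : ∀ {x y z m n v i j} {p : Walk E x y m} {q : Walk E y z n} → At p v i j → At (p ++ q) v i (j + n)
  at-++ˡ start      = start
  at-++ˡ (next v∈p) = next (at-++ˡ v∈p)

  at-++ʳ : ∀ {x y z m n v i j} (p : Walk E x y m) {q : Walk E y z n} → At q v i j → At (p ++ q) v (m + i) j
  at-++ʳ nil        v∈q = v∈q
  at-++ʳ (cons e p) v∈q = next (at-++ʳ p v∈q)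

  on-++⁻ : ∀ {x y z m n v} (p : Walk E x y m) {q : Walk E y z n} → On (p ++ q) v → On p v ⊎ On q v
  on-++⁻ nil        v∈q                  = inj₂ v∈q
  on-++⁻ (cons e p) (_ , _ , start)      = inj₁ (_ , _ , start)
  on-++⁻ (cons e p) (_ , _ , next v∈p++q) with on-++⁻ p (_ , _ , v∈p++q)
  ... | inj₁ v∈p = inj₁ (on-next v∈p)
  ... | inj₂ v∈q = inj₂ v∈q

  backward : ∀ {x y n v j} i {s} {p : Walk E x y n} → At p v (i + s) j →
    ∃ λ z → On p z × Walk E x z i × Walk E z v s
  backward zero    v∈p        = _ , (_ , _ , start) , nil , before v∈p
  backward (suc i) (next {e = e} v∈p) =
    let z , z∈p , xz , zv = backward i v∈p in z , on-next z∈p , cons e xz , zv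

  on-split : ∀ {x y} s {j} (p : Walk E x y (s + j)) → ∃ λ z → On p z × Walk E x z s × Walk E z y j
  on-split zero    p          = _ , (_ , _ , start) , nil , p
  on-split (suc s) (cons e p) =
    let z , z∈p , xz , zy = on-split s p in z , on-next z∈p , cons e xz , zy

  forward : ∀ {x y n v i} s {j} {p : Walk E x y n} → At p v i (s + j) →
    ∃ λ z → On p z × Walk E v z s × Walk E z y j
  forward s {p = p} start = on-split s p
  forward s (next v∈p)    =
    let z , z∈p , vz , zy = forward s v∈p in z , on-next z∈p , vz , zy

  Straight : (V → Set (a ⊔ b)) → ℕ → V → Set (a ⊔ b)
  Straight X s v = Σ V λ p → Σ V λ q → X p × X q × Walk E v p s × Walk E v q s × Far p q (s + s)

  geodesic-straight : ∀ {x y n v i j} s {p : Walk E x y n} → Far x y n → At p v i j → s ≤ i → s ≤ j →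
    Straight (On p) s v
  geodesic-straight {n = n} {i = i} {j} s {p} f v∈p s≤i s≤j =
    let p₁ , p₁∈ , xp₁ , p₁v = backward (i ∸ s) (subst (λ i → At p _ i j) (sym (m∸n+n≡m s≤i)) v∈p)
        p₂ , p₂∈ , vp₂ , p₂y = forward s (subst (At p _ i) (sym (m+[n∸m]≡n s≤j)) v∈p)
    in p₁ , p₂ , p₁∈ , p₂∈ , rev p₁v , vp₂ , far-narrow (i ∸ s) (j ∸ s) f xp₁ p₂y (≤-reflexive lemma)
    where
    open ≡-Reasoning
    lemma : i ∸ s + (s + s) + (j ∸ s) ≡ n
    lemma = begin
      i ∸ s + (s + s) + (j ∸ s)   ≡⟨ cong (_+ (j ∸ s)) (sym (+-assoc (i ∸ s) s s)) ⟩
      i ∸ s + s + s + (j ∸ s)     ≡⟨ +-assoc (i ∸ s + s) s (j ∸ s) ⟩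
      i ∸ s + s + (s + (j ∸ s))   ≡⟨ cong (_+ (s + (j ∸ s))) (m∸n+n≡m s≤i) ⟩
      i + (s + (j ∸ s))           ≡⟨ cong (i +_) (m+[n∸m]≡n s≤j) ⟩
      i + j                       ≡⟨ at-length v∈p ⟩
      n                           ∎

  module _ {X : V → Set (a ⊔ b)} where

    straight-mono : ∀ {Y : V → Set (a ⊔ b)} {s v} → (∀ {z} → Y z → X z) → Straight Y s v → Straight X s v
    straight-mono Y⊆X (p , q , p∈ , q∈ , rest) = p , q , Y⊆X p∈ , Y⊆X q∈ , rest

    -- Since the middle side has length at least `s + s`, `v` is at least `s` away from one of its
    -- ends. The window of radius `s` about `v` then fits in that side together with the one beyond
    -- the other end, and these two form a geodesic.
    side-straight : ∀ {x y z t l m n v} s {p : Walk E x y l} {q : Walk E y z m} {r : Walk E z t n} →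
      (∀ {z} → On p z → X z) → (∀ {z} → On q z → X z) → (∀ {z} → On r z → X z) →
      s ≤ l → s + s ≤ m → s ≤ n → Far x z (l + m) → Far y t (m + n) →
      On q v → Straight X s v
    side-straight {l = l} {m} {n} s {p} {q} {r} p⊆ q⊆ r⊆ s≤l 2s≤m s≤n fpq fqr (i , j , v∈q) with s ≤? i
    ... | yes s≤i = straight-mono ([ q⊆ , r⊆ ] ∘ on-++⁻ q)
                      (geodesic-straight s fqr (at-++ˡ v∈q) s≤i (≤-trans s≤n (m≤n+m n j)))
    ... | no s≰i = straight-mono ([ p⊆ , q⊆ ] ∘ on-++⁻ p)
                      (geodesic-straight s fpq (at-++ʳ p v∈q) (≤-trans s≤l (m≤m+n l i)) s≤j)
      where
      s≤j : s ≤ j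
      s≤j = +-cancelˡ-≤ s s j (≤-trans 2s≤m (≤-trans (≤-reflexive (sym (at-length v∈q)))
              (+-monoˡ-≤ j (<⇒≤ (≰⇒> s≰i)))))

  module _ {s s′ : ℕ} (s′<s : s′ < s) (dismantlable : IsDismantlable G s s′) where
    private module W = WellOrder (proj₁ dismantlable)
    open W using (_≼_)
    open IsTotalOrder W.isTotal using (total; antisym) renaming (refl to ≼-refl; trans to ≼-trans)

    avoid-or-hit : ∀ u {x y n} → Walk E x y n → ¬ ¬ (WalkAvoid E u x y n ⊎ ∃ λ m → m ≤ n × Walk E u y m)
    avoid-or-hit u {x} p = do
      no x≢u ← ¬¬-excluded-middle {A = x ≡ u}
        where yes refl → return (inj₂ (_ , ≤-refl , p))
      go x≢u p
      where
      go : ∀ {x y n} → x ≢ u → Walk E x y n → ¬ ¬ (WalkAvoid E u x y n ⊎ ∃ λ m → m ≤ n × Walk E u y m)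
      go x≢u nil = return (inj₁ (nil x≢u))
      go x≢u (cons e p) = do
        inj₁ q ← avoid-or-hit u p
          where inj₂ (m , m≤n , q) → return (inj₂ (m , m≤n⇒m≤1+n m≤n , q))
        return (inj₁ (cons x≢u e q))

    -- Whether or not a walk of length s from v meets the dominating vertex u, its end is
    -- at distance less than s from u.
    dominated : ∀ {u v p n} → u ≢ v → (∀ x → InBallMinus G u s v x → x ≼ v → InBall G s′ u x) →
      n ≡ s → Walk E v p n → p ≼ v → ¬ ¬ ∃ λ m → m < s × Walk E u p m
    dominated u≢v dom refl nil p≼v = λ _ → n≮0 s′<s
    dominated {u} {v} u≢v dom refl (cons e p) p≼v = do
      inj₁ q ← avoid-or-hit u p
        where inj₂ (m , m≤n , q) → return (m , s≤s m≤n , q)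
      let m , m≤s′ , r = dom _ (s , ≤-refl , cons (u≢v ∘ sym) e q) p≼v
      return (m , ≤-<-trans m≤s′ s′<s , r)

    Greatest : (V → Set (a ⊔ b)) → Set (a ⊔ b)
    Greatest X = Σ V λ v → X v × (∀ {z} → X z → z ≼ v)

    greatest-∪ : ∀ {X Y} → Greatest X → Greatest Y → Greatest (λ v → X v ⊎ Y v)
    greatest-∪ (v , v∈ , ≼v) (w , w∈ , ≼w) with total v w
    ... | inj₁ v≼w = w , inj₂ w∈ , [ (λ z∈ → ≼-trans (≼v z∈) v≼w) , ≼w ]
    ... | inj₂ w≼v = v , inj₁ v∈ , [ ≼v , (λ z∈ → ≼-trans (≼w z∈) w≼v) ]

    greatest-on : ∀ {x y n} (p : Walk E x y n) → Greatest (On p)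
    greatest-on nil = _ , (_ , _ , start) , λ { (_ , _ , start) → ≼-refl }
    greatest-on {x} (cons e p) with greatest-on p
    ... | v , v∈ , ≼v with total x v
    ...   | inj₁ x≼v = v , on-next v∈ , λ { (_ , _ , start) → x≼v ; (_ , _ , next z∈) → ≼v (_ , _ , z∈) }
    ...   | inj₂ v≼x = x , (_ , _ , start) ,
                       λ { (_ , _ , start) → ≼-refl ; (_ , _ , next z∈) → ≼-trans (≼v (_ , _ , z∈)) v≼x }

    no-straight : ∀ {X} ((v , _) : Greatest X) → ¬ Straight X s v
    no-straight (v , _ , ≼v) (p , q , p∈ , q∈ , vp , vq , f) = far contr
      where
      far : ¬ ¬ (s + s ≤ 0 ⊎ ∃ λ m → m < s + s × Walk E p q m)
      far = do
        -- Domination exempts the least vertex. If the greatest element `v` of `X` is also least,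
        -- then `p = q = v` and `Far` forces `s + s ≤ 0`.
        no v≢min ← ¬¬-excluded-middle {A = ∀ w → v ≼ w}
          where yes v-min → return (inj₁ (case antisym (≼v p∈) (v-min p) of λ where
                  refl → case antisym (≼v q∈) (v-min q) of λ where
                    refl → f 0 nil))
        let u , u≢v , _ , dom = proj₂ dismantlable v v≢min
        m , m<s , up ← dominated u≢v dom refl vp (≼v p∈)
        n , n<s , uq ← dominated u≢v dom refl vq (≼v q∈)
        return (inj₂ (m + n , +-mono-< m<s n<s , rev up ++ uq))
      contr : ¬ (s + s ≤ 0 ⊎ ∃ λ m → m < s + s × Walk E p q m)
      contr (inj₁ 2s≤0) = n≮0 (≤-trans s′<s (≤-trans (m≤m+n s s) 2s≤0))
      contr (inj₂ (m , m<2s , pq)) = <⇒≱ m<2s (f m pq)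

    -- Long sides, any two consecutive ones forming a geodesic, make every vertex `Straight`. Six
    -- sides fit both uses: a triangle with its corners cut off, and a bigon with each of its two
    -- paths divided into three.
    no-hexagon : ∀ {x₀ x₁ x₂ x₃ x₄ x₅ n₀ n₁ n₂ n₃ n₄ n₅} →
      Walk E x₀ x₁ n₀ → Walk E x₁ x₂ n₁ → Walk E x₂ x₃ n₂ →
      Walk E x₃ x₄ n₃ → Walk E x₄ x₅ n₄ → Walk E x₅ x₀ n₅ →
      s + s ≤ n₀ → s + s ≤ n₁ → s + s ≤ n₂ → s + s ≤ n₃ → s + s ≤ n₄ → s + s ≤ n₅ →
      Far x₀ x₂ (n₀ + n₁) → Far x₁ x₃ (n₁ + n₂) → Far x₂ x₄ (n₂ + n₃) →
      Far x₃ x₅ (n₃ + n₄) → Far x₄ x₀ (n₄ + n₅) → Far x₅ x₁ (n₅ + n₀) → ⊥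
    no-hexagon p₀ p₁ p₂ p₃ p₄ p₅ l₀ l₁ l₂ l₃ l₄ l₅ f₀ f₁ f₂ f₃ f₄ f₅ =
      no-straight g (on-side (proj₁ (proj₂ g)))
      where
      X : V → Set (a ⊔ b)
      X v = ((On p₀ v ⊎ On p₁ v) ⊎ (On p₂ v ⊎ On p₃ v)) ⊎ (On p₄ v ⊎ On p₅ v)
      g : Greatest X
      g = greatest-∪ (greatest-∪ (greatest-∪ (greatest-on p₀) (greatest-on p₁))
                                 (greatest-∪ (greatest-on p₂) (greatest-on p₃)))
                     (greatest-∪ (greatest-on p₄) (greatest-on p₅))
      i₀ : ∀ {z} → On p₀ z → X z
      i₀ = inj₁ ∘ inj₁ ∘ inj₁
      i₁ : ∀ {z} → On p₁ z → X z
      i₁ = inj₁ ∘ inj₁ ∘ inj₂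
      i₂ : ∀ {z} → On p₂ z → X z
      i₂ = inj₁ ∘ inj₂ ∘ inj₁
      i₃ : ∀ {z} → On p₃ z → X z
      i₃ = inj₁ ∘ inj₂ ∘ inj₂
      i₄ : ∀ {z} → On p₄ z → X z
      i₄ = inj₂ ∘ inj₁
      i₅ : ∀ {z} → On p₅ z → X z
      i₅ = inj₂ ∘ inj₂
      h : ∀ {n} → s + s ≤ n → s ≤ n
      h = ≤-trans (m≤m+n s s)
      on-side : ∀ {v} → X v → Straight X s v
      on-side (inj₁ (inj₁ (inj₁ v∈))) = side-straight s i₅ i₀ i₁ (h l₅) l₀ (h l₁) f₅ f₀ v∈
      on-side (inj₁ (inj₁ (inj₂ v∈))) = side-straight s i₀ i₁ i₂ (h l₀) l₁ (h l₂) f₀ f₁ v∈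
      on-side (inj₁ (inj₂ (inj₁ v∈))) = side-straight s i₁ i₂ i₃ (h l₁) l₂ (h l₃) f₁ f₂ v∈
      on-side (inj₁ (inj₂ (inj₂ v∈))) = side-straight s i₂ i₃ i₄ (h l₂) l₃ (h l₄) f₂ f₃ v∈
      on-side (inj₂ (inj₁ v∈))        = side-straight s i₃ i₄ i₅ (h l₃) l₄ (h l₅) f₃ f₄ v∈
      on-side (inj₂ (inj₂ v∈))        = side-straight s i₄ i₅ i₀ (h l₄) l₅ (h l₀) f₄ f₅ v∈

-- Size of metric triangles.

module Bounds {a b : Level} (G : Graph a b) (wm : WeaklyModular G) {s s′ : ℕ} (s′<s : s′ < s)
              (dis : IsDismantlable G s s′) (t : ℕ) (2s≤t : s + s ≤ t) where
  open Graph G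
  open Walks G
  open Modular G wm
  open Dismantling G

  -- The hexagon is c₂ c₁ b b₁ a₁ a₂ with a₁, a₂ on I(u,v), c₁, c₂ on I(u,w) and b₁, b on I(v,w).
  -- Here b is a corner of the quasi-median of w, c₁, b₁, so that c₁ b b₁ is geodesic; the path
  -- c₂ c₁ b is geodesic because d(u,b) = 3t.
  no-triangle-3t : ∀ {u v w} → ¬ MetricTriangle u v w (t + (t + t))
  no-triangle-3t {u} {v} {w} T = hexagon id
    where
    module T = MetricTriangle T
    3t : t + t + t ≡ t + (t + t)
    3t = +-assoc t t t

    finish : ∀ {a₁ b₁ c₁ a₂ c₂} → Walk E v a₁ t → Walk E a₁ u (t + t) → Walk E v b₁ t → Walk E b₁ w (t + t) →
      Walk E b₁ a₁ t → Walk E u c₁ (t + t) → Walk E c₁ w t → Walk E a₁ a₂ t → Walk E a₂ u t →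
      Walk E u c₂ t → Walk E c₂ c₁ t → Walk E a₂ c₂ t → ¬ QuasiMedian w c₁ b₁
    finish {a₁} {b₁} {c₁} {a₂} {c₂} va₁ a₁u vb₁ b₁w b₁a₁ uc₁ c₁w a₁a₂ a₂u uc₂ c₂c₁ a₂c₂ q =
      no-hexagon s′<s dis c₂c₁ c₁b b₁b b₁a₁ a₁a₂ a₂c₂
        2s≤t (≤-trans 2s≤t t≤β+k) (≤-trans 2s≤t t≤γ) 2s≤t 2s≤t 2s≤t
        (far-narrowˡ t fub uc₂ (+-monoʳ-≤ t (+-monoʳ-≤ t β+k≤t)))
        fvw
        -- This bend and the next three extend, like the first, to a path of length `3t` between a
        -- corner of `T` and a point of the opposite side, which `side-far` makes geodesic.
        (far-narrowˡ (α + k) (side-far (rotate (rotate T)) (rev a₁u) (rev va₁) 3t) wb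
          (≤-reflexive (trans (sym (+-assoc (α + k) γ t)) (trans (cong (_+ t) (sym wb₁≡)) 3t))))
        (far-narrowʳ t (far-sym (side-far T vb₁ b₁w refl)) a₂u (≤-reflexive 3t))
        (far-narrowˡ t (side-far (swap T) uc₂ (c₂c₁ ++ c₁w) refl) va₁ ≤-refl)
        (far-sym (far-narrowˡ t (side-far (rotate (rotate T)) (rev a₂u) (rev a₁a₂ ++ rev va₁) refl)
                               (rev c₁w) ≤-refl))
      where
      open QuasiMedian q
      module C = MetricTriangle core
      wb : Walk E w w′ (α + k)
      wb = uu′ ++ proj₁ C.duw
      c₁b : Walk E c₁ w′ (β + k)
      c₁b = vv′ ++ proj₁ C.dvw
      b₁b : Walk E w′ b₁ γ
      b₁b = rev ww′
      wc₁≡ : t ≡ α + k + β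
      wc₁≡ = dist-unique (dist-sym (dist-suffix (subst (Far u w) (sym 3t) (proj₂ T.duw)) uc₁ c₁w)) duv
      wb₁≡ : t + t ≡ α + k + γ
      wb₁≡ = dist-unique (dist-sym (dist-suffix (proj₂ T.dvw) vb₁ b₁w)) duw
      fub : Far u w′ (t + (t + t))
      fub = side-far T (vb₁ ++ ww′) (rev wb) (trans (lemma t α k γ) (cong (t +_) (sym wb₁≡)))
        where
        lemma : ∀ t α k γ → t + γ + (α + k) ≡ t + (α + k + γ)
        lemma t α k γ = solve (t ∷ α ∷ k ∷ γ ∷ [])
      -- The walk from `u` to `c₁` has length `2t` and `b` is at distance at least `3t` from `u`.
      -- With `β+k≤t` the side from `c₁` to `b` has length exactly `t`.
      t≤β+k : t ≤ β + k
      t≤β+k = +-cancelˡ-≤ t t (β + k) (+-cancelˡ-≤ t (t + t) (t + (β + k)) (fub _ (uc₂ ++ c₂c₁ ++ c₁b)))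
      β+k≤t : β + k ≤ t
      β+k≤t = cancel-≤ α (≤-reflexive (sym wc₁≡)) (lemma α β k)
        where
        lemma : ∀ α β k → β + k + t + α ≡ t + (α + k + β)
        lemma α β k = solve (t ∷ α ∷ k ∷ β ∷ [])
      t≤γ : t ≤ γ
      t≤γ = cancel-≤ β (≤-reflexive (cong₂ _+_ wb₁≡ (sym wc₁≡))) (lemma α β γ k)
        where
        lemma : ∀ α β γ k → t + (α + k + γ + t) + β ≡ γ + (t + t + (α + k + β))
        lemma α β γ k = solve (t ∷ α ∷ k ∷ β ∷ γ ∷ [])

    hexagon : ¬ ¬ ⊥
    hexagon = do
      -- `T₁` and `T₃` are the corners of side `t` at `v` and at `u`; `T₂`, of side `2t` at `u`,
      -- supplies `c₁`. At `w` the points `c₁` and `b₁` have distances `t` and `2t`, so a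
      -- quasi-median is used there.
      let a₁ , va₁ , a₁u = split t (rev (proj₁ T.duv))
      b₁ , vb₁ , b₁w , T₁ ← subtriangle T (rev a₁u) (rev va₁) 3t
      c₁ , uc₁ , c₁w , T₂ ← subtriangle (swap T) va₁ a₁u refl
      let a₂ , a₁a₂ , a₂u = split t (proj₁ (MetricTriangle.duv T₂))
      c₂ , uc₂ , c₂c₁ , T₃ ← subtriangle T₂ a₁a₂ a₂u refl
      q ← quasiMedian w c₁ b₁
      return (finish va₁ a₁u vb₁ b₁w (rev (proj₁ (MetricTriangle.duw T₁))) uc₁ c₁w a₁a₂ a₂u uc₂ c₂c₁
               (proj₁ (MetricTriangle.duw T₃)) q)

  -- A larger triangle would contain one of side exactly `3t`, cut off at a corner.
  side-bound : ∀ {u v w k} → MetricTriangle u v w k → k < t + (t + t)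
  side-bound {u} {v} {w} {k} T = ≰⇒> λ 3t≤k →
    let eq = m+[n∸m]≡n 3t≤k
        a , va , au = split (t + (t + t)) (cast (sym eq) (rev (proj₁ (MetricTriangle.duv T))))
    in subtriangle T (rev au) (rev va) (trans (+-comm (k ∸ (t + (t + t))) _) eq)
         λ (_ , _ , _ , T′) → no-triangle-3t T′

  -- Thin intervals.

  -- One side of the bigon: a path from `x` to `y` of length `d` whose two end pieces, of length
  -- `t`, also head towards `u`.
  record Legs (u x y : V) (i d : ℕ) : Set (a ⊔ b) where
    field
      {x₁ y₁} : V
      {e f}   : ℕ
      xx₁     : Walk E x x₁ t
      x₁y₁    : Walk E x₁ y₁ e
      y₁y     : Walk E y₁ y t
      ux₁     : Walk E u x₁ f
      uy₁     : Walk E u y₁ f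
      t≤e     : t ≤ e
      length  : t + (e + t) ≡ d
      height  : f + t ≡ i

  -- In the quasi-median of `u`, `x`, `y` the legs at `x` and `y` are equal, because
  -- `d(u,x) = d(u,y)`. The core has side below `3t`, so `d ≥ 5t` leaves at least `t` for each leg.
  legs : ∀ {u x y i d} → Dist G u x i → Dist G u y i → Dist G x y d → 5 * t ≤ d → ¬ ¬ Legs u x y i d
  legs {u} {x} {y} {i} {d} dux duy dxy 5t≤d = do
    q ← quasiMedian u x y
    let module Q = QuasiMedian q
        module C = MetricTriangle Q.core
        d≡ = dist-unique dxy Q.dvw
        β≡γ = +-cancelˡ-≡ (Q.α + Q.k) Q.β Q.γ (trans (dist-unique Q.duv dux) (dist-unique duy Q.duw))
        eq = m+[n∸m]≡n (t≤β Q.β Q.k (side-bound Q.core)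
               (≤-trans 5t≤d (≤-reflexive (trans d≡ (cong (Q.β + Q.k +_) (sym β≡γ))))))
    return (build Q.uu′ Q.vv′ Q.ww′ (proj₁ C.duv) (proj₁ C.duw) (proj₁ C.dvw) (sym eq)
             (trans (sym β≡γ) (sym eq)) (dist-unique dux Q.duv) d≡)
    where
    t≤β : ∀ β k → k < t + (t + t) → 5 * t ≤ β + k + β → t ≤ β
    t≤β β k k<3t 5t≤ = ≮⇒≥ λ β<t →
      n≮0 (cancel-≤ {1} {0} 2 (+-mono-≤ (+-mono-≤ (+-mono-≤ β<t β<t) k<3t) 5t≤) (lemma t β k))
      where
      lemma : ∀ t β k → 1 + (t + t + (t + (t + t)) + (β + k + β)) + 2 ≡ 0 + (suc β + suc β + suc k + 5 * t)
      lemma t β k = solve (t ∷ β ∷ k ∷ [])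

    build : ∀ {u′ x′ y′ α β γ k r} → Walk E u u′ α → Walk E x x′ β → Walk E y y′ γ →
      Walk E u′ x′ k → Walk E u′ y′ k → Walk E x′ y′ k →
      β ≡ t + r → γ ≡ t + r → i ≡ α + k + β → d ≡ β + k + γ → Legs u x y i d
    build {α = α} {k = k} {r} uu′ xx′ yy′ u′x′ u′y′ x′y′ refl refl refl refl =
      let x₁ , xx₁ , x₁x′ = split t xx′
          y₁ , yy₁ , y₁y′ = split t yy′
      in record
        { xx₁ = xx₁ ; x₁y₁ = x₁x′ ++ x′y′ ++ rev y₁y′ ; y₁y = rev yy₁
        ; ux₁ = (uu′ ++ u′x′) ++ rev x₁x′ ; uy₁ = (uu′ ++ u′y′) ++ rev y₁y′
        ; t≤e = cancel-≤ (t + t) 5t≤d (lemma₁ t r k) ; length = lemma₂ t r k ; height = lemma₃ t r k α }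
      where
      lemma₁ : ∀ t r k → t + (t + r + k + (t + r)) + (t + t) ≡ r + (k + r) + 5 * t
      lemma₁ t r k = solve (t ∷ r ∷ k ∷ [])
      lemma₂ : ∀ t r k → t + (r + (k + r) + t) ≡ t + r + k + (t + r)
      lemma₂ t r k = solve (t ∷ r ∷ k ∷ [])
      lemma₃ : ∀ t r k α → α + k + r + t ≡ α + k + (t + r)
      lemma₃ t r k α = solve (t ∷ r ∷ k ∷ α ∷ [])

  -- A wide bigon between x and y inside I(u,v), one side towards u and the other towards v,
  -- is locally geodesic: at x and y because both lie on geodesics from u to v.
  thin-intervals : ∀ {u v x y i j d} → Far u v (i + j) → Walk E u x i → Walk E x v j →
    Walk E u y i → Walk E y v j → Dist G x y d → d < 5 * t
  thin-intervals {u} {v} {x} {y} {i} {j} {d} fuv ux xv uy yv dxy = ≰⇒> λ 5t≤d →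
    legs (dist-prefix fuv ux xv) (dist-prefix fuv uy yv) dxy 5t≤d λ p →
    legs (dist-sym (dist-suffix fuv ux xv)) (dist-sym (dist-suffix fuv uy yv)) dxy 5t≤d λ q →
    hexagon p q
    where
    hexagon : Legs u x y i d → Legs v x y j d → ⊥
    hexagon p q = no-hexagon s′<s dis
      P.xx₁ P.x₁y₁ P.y₁y (rev Q.y₁y) (rev Q.x₁y₁) (rev Q.xx₁)
      2s≤t (≤-trans 2s≤t P.t≤e) 2s≤t 2s≤t (≤-trans 2s≤t Q.t≤e) 2s≤t
      (far-narrowʳ t fxy P.y₁y (≤-reflexive (trans (+-assoc t P.e t) P.length)))
      (far-narrowˡ t fxy P.xx₁ (≤-reflexive P.length))
      (corner P.uy₁ Q.uy₁ P.height Q.height)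
      (far-sym (far-narrowˡ t fxy Q.xx₁ (≤-reflexive (trans (cong (t +_) (+-comm t Q.e)) Q.length))))
      (far-sym (far-narrowʳ t fxy Q.y₁y (≤-reflexive
        (trans (+-comm (Q.e + t) t) Q.length))))
      (far-sym (corner P.ux₁ Q.ux₁ P.height Q.height))
      where
      module P = Legs p
      module Q = Legs q
      fxy = proj₂ dxy
      corner : ∀ {z₁ z₂ f g} → Walk E u z₁ f → Walk E v z₂ g → f + t ≡ i → g + t ≡ j → Far z₁ z₂ (t + t)
      corner {f = f} {g} uz₁ vz₂ refl refl = far-narrow f g fuv uz₁ (rev vz₂) (≤-reflexive (lemma t f g))
        where
        lemma : ∀ t f g → f + (t + t) + g ≡ f + t + (g + t)
        lemma t f g = solve (t ∷ f ∷ g ∷ [])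

  -- The four-point inequality.

  -- Let `p` lie at height `α` on the leg of `q′` at `u`. Both `p` and the corner `u′` of `q` lie in
  -- `I(u,x)` at that height, so they are less than `5t` apart. Going from `v` to `y` through `u′`
  -- and `p` costs at most this gap and one core side, below `3t`: together `8t`.
  fork : ∀ {u v x y ux vy vx uy} → Dist G u x ux → Dist G v y vy → Dist G v x vx → Dist G u y uy →
    (q : QuasiMedian u v x) (q′ : QuasiMedian u x y) → QuasiMedian.α q ≤ QuasiMedian.α q′ →
    vy + ux ≤ vx + uy + 8 * t
  fork {u} {v} {x} {y} {ux} {vy} {vx} {uy} dux dvy dvx duy q q′ α≤α′ =
    let p , up , pu′ = split Q.α (cast (sym eq) Q′.uu′)
    in ≤-stable do
      d , dup ← ∃dist Q.u′ p
      return (bound d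
        (thin-intervals (far-≤ (≤-reflexive (sym (+-assoc Q.α Q.k Q.γ))) Q.fuw) Q.uu′ (proj₁ C.duw ++ rev Q.ww′) up
          (cast same-height (pu′ ++ proj₁ C′.duv ++ rev Q′.vv′)) dup)
        (proj₂ dvy _ (Q.vv′ ++ rev (proj₁ C.duv) ++ proj₁ dup ++ pu′ ++ proj₁ C′.duw ++ rev Q′.ww′)))
    where
    module Q = QuasiMedian q
    module C = MetricTriangle Q.core
    module Q′ = QuasiMedian q′
    module C′ = MetricTriangle Q′.core
    r : ℕ
    r = Q′.α ∸ Q.α
    eq : Q.α + r ≡ Q′.α
    eq = m+[n∸m]≡n α≤α′
    same-height : r + (Q′.k + Q′.β) ≡ Q.k + Q.γ
    same-height = cancel-≡ (trans (cong (λ α → α + Q′.k + Q′.β) eq) (dist-unique Q′.duv Q.duw))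
      (lemma Q.α r Q′.k Q′.β Q.k Q.γ)
      where
      lemma : ∀ α r k′ β′ k γ → r + (k′ + β′) + (α + k + γ) ≡ k + γ + (α + r + k′ + β′)
      lemma α r k′ β′ k γ = solve (α ∷ r ∷ k′ ∷ β′ ∷ k ∷ γ ∷ [])
    bound : ∀ d → d < 5 * t → vy ≤ Q.β + (Q.k + (d + (r + (Q′.k + Q′.γ)))) → vy + ux ≤ vx + uy + 8 * t
    bound d d<5t vy≤ = cancel-≤ 2 (+-mono-≤ (+-mono-≤ (+-mono-≤ vy≤ (≤-reflexive (dist-unique dux Q.duw)))
        (+-mono-≤ (≤-reflexive (dist-unique Q.dvw dvx))
                  (≤-reflexive (trans (cong (λ α → α + Q′.k + Q′.γ) eq) (dist-unique Q′.duw duy)))))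
        (+-mono-≤ d<5t (side-bound Q.core)))
      (lemma Q.α Q.β Q.γ Q.k Q′.k Q′.γ d r t vx vy ux uy)
      where
      lemma : ∀ α β γ k k′ γ′ d r t vx vy ux uy →
        vy + ux + (β + (k + (d + (r + (k′ + γ′)))) + (α + k + γ) + (vx + uy) + (5 * t + (t + (t + t)))) + 2 ≡
        vx + uy + 8 * t + (vy + ux + (β + k + γ + (α + r + k′ + γ′)) + (suc d + suc k))
      lemma α β γ k k′ γ′ d r t vx vy ux uy =
        solve (α ∷ β ∷ γ ∷ k ∷ k′ ∷ γ′ ∷ d ∷ r ∷ t ∷ vx ∷ vy ∷ ux ∷ uy ∷ [])

  -- The quasi-median with the shorter leg at `u` plays the role of `q` in `fork`; exchanging `v`
  -- and `y` turns one upper bound into the other.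
  four-point : ∀ {u v x y uv xy ux vy vx uy} → Dist G u v uv → Dist G x y xy → Dist G u x ux →
    Dist G v y vy → Dist G u y uy → Dist G v x vx → ux + vy ≤ (uv + xy ⊔ℕ (uy + vx)) + 8 * t
  four-point {u} {v} {x} {y} {uv} {xy} {ux} {vy} {vx} {uy} duv dxy dux dvy duy dvx = ≤-stable do
    q ← quasiMedian u v x
    q′ ← quasiMedian u x y
    return (≤-trans (≤-reflexive (+-comm ux vy)) (case ≤-total (QuasiMedian.α q) (QuasiMedian.α q′) of λ where
      (inj₁ α≤α′) → ≤-trans (fork dux dvy dvx duy q q′ α≤α′)
        (+-monoˡ-≤ (8 * t) (≤-trans (≤-reflexive (+-comm vx uy)) (m≤n⊔m (uv + xy) (uy + vx))))
      (inj₂ α′≤α) → ≤-trans (fork dux (dist-sym dvy) (dist-sym dxy) duv (qm-swap q′) (qm-swap q) α′≤α)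
        (+-monoˡ-≤ (8 * t) (≤-trans (≤-reflexive (+-comm xy uv)) (m≤m⊔n (uv + xy) (uy + vx))))))

-- From the four-point inequality to hyperbolicity.

-- The maximum of the pairwise minima is the middle value. Distributing the minimum over the maximum
-- bounds each of the three numbers by it, up to `c`.
two-largest-within : ∀ {p q r} c → p ≤ (q ⊔ℕ r) + c → q ≤ (p ⊔ℕ r) + c → r ≤ (p ⊔ℕ q) + c →
  TwoLargestWithin c p q r
two-largest-within {p} {q} {r} c hp hq hr =
  m≤n+o⇒m∸n≤o _ _ (⊔-lub (⊔-lub p≤ q≤) r≤)
  where
  median : ℕ
  median = ((p ⊓ q) ⊔ℕ (q ⊓ r)) ⊔ℕ (p ⊓ r)
  pq≤ : p ⊓ q ≤ median
  pq≤ = ≤-trans (m≤m⊔n _ (q ⊓ r)) (m≤m⊔n _ (p ⊓ r))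
  qr≤ : q ⊓ r ≤ median
  qr≤ = ≤-trans (m≤n⊔m (p ⊓ q) _) (m≤m⊔n _ (p ⊓ r))
  pr≤ : p ⊓ r ≤ median
  pr≤ = m≤n⊔m ((p ⊓ q) ⊔ℕ (q ⊓ r)) _
  bound : ∀ x y z → x ⊓ y ≤ median → x ⊓ z ≤ median → x ≤ (y ⊔ℕ z) + c → x ≤ median + c
  bound x y z xy≤ xz≤ h = begin
    x                             ≤⟨ ⊓-glb (m≤m+n x c) h ⟩
    (x + c) ⊓ ((y ⊔ℕ z) + c)      ≡⟨ sym (+-distribʳ-⊓ c x (y ⊔ℕ z)) ⟩
    (x ⊓ (y ⊔ℕ z)) + c            ≡⟨ cong (_+ c) (⊓-distribˡ-⊔ x y z) ⟩
    ((x ⊓ y) ⊔ℕ (x ⊓ z)) + c      ≤⟨ +-monoˡ-≤ c (⊔-lub xy≤ xz≤) ⟩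
    median + c                    ∎
    where open ≤-Reasoning
  p≤ : p ≤ median + c
  p≤ = bound p q r pq≤ pr≤ hp
  q≤ : q ≤ median + c
  q≤ = bound q p r (≤-trans (≤-reflexive (⊓-comm q p)) pq≤) qr≤ hq
  r≤ : r ≤ median + c
  r≤ = bound r p q (≤-trans (≤-reflexive (⊓-comm r p)) pr≤) (≤-trans (≤-reflexive (⊓-comm r q)) qr≤) hr

theorem4 : {a b : Level} (s s' : ℕ) → s' < s → (G : Graph a b) →
    WeaklyModular G → IsDismantlable G s s' → Hyperbolic G (184 * s)
theorem4 s s' s'<s G wm dis u v x y duv dxy dux dvy duy dvx Duv Dxy Dux Dvy Duy Dvx =
  -- With `t = 2s` the error `8t` is `16s`, and `352s` is the slack up to `2 * 184s`.
  ≤-trans (two-largest-within (8 * (s + s)) hp hq hr) (cancel-≤ (352 * s) ≤-refl (lemma s))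
  where
  open Walks G
  open Bounds G wm s'<s dis (s + s) ≤-refl
  lemma : ∀ s → 8 * (s + s) + 0 + 352 * s ≡ 2 * (184 * s) + 0
  lemma s = solve (s ∷ [])
  hp : duv + dxy ≤ ((dux + dvy) ⊔ℕ (duy + dvx)) + 8 * (s + s)
  hp = four-point Dux Dvy Duv Dxy Duy (dist-sym Dvx)
  hq : dux + dvy ≤ ((duv + dxy) ⊔ℕ (duy + dvx)) + 8 * (s + s)
  hq = four-point Duv Dxy Dux Dvy Duy Dvx
  hr : duy + dvx ≤ ((duv + dxy) ⊔ℕ (dux + dvy)) + 8 * (s + s)
  hr = four-point Duv (dist-sym Dxy) Duy Dvx Dux Dvy
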